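{- Let $t, s \ge 0$, $k \ge s+1$ and $n \ge 2k+t$ be integers. Let $\mathcal{F} \subseteq \binom{[n]}{k+t}$ and $\mathcal{G} \subseteq \binom{[n]}{k}$ be cross-intersecting families. If $\mathcal{F}$ is $(t+1)$-intersecting and $\binom{[k+t+s]}{k+t} \subseteq \mathcal{F}$, then $$|\mathcal{F}|+|\mathcal{G}| \le \binom{k+t+s}{k+t}+\binom{n}{k}-\sum_{i=0}^{s}\binom{k+t+s}{i}\binom{n-k-t-s}{k-i}.$$
   Context: $[n]=\{1,2,\ldots,n\}$, and for a set $X$, $\binom{X}{k}$ denotes the family of all $k$-element subsets of $X$. Two families $\mathcal{F},\mathcal{G}\subseteq 2^{[n]}$ are cross-intersecting if $|F\cap G|\ge 1$ for all $F\in\mathcal{F}$ and $G\in\mathcal{G}$. A family $\mathcal{F}\subseteq 2^{[n]}$ is $r$-intersecting if $|F\cap F'|\ge r$ for all $F,F'\in\mathcal{F}$. A binomial coefficient $\binom{a}{b}$ with integers $0\le a<b$ is $0$. -}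

module Defs where

open import Data.Fin.Base using (toℕ)
open import Data.Fin.Subset using (Subset; _∩_; ∣_∣) renaming (_⊆_ to _⊆ˢ_)
open import Data.List.Base using (List; length)
open import Data.List.Membership.Propositional using (_∈_)
open import Data.List.Relation.Unary.Unique.Propositional using (Unique)
open import Data.Nat.Base using (ℕ; _≤_; _<ᵇ_)
open import Data.Product.Base using (_×_)
open import Data.Vec.Base using (tabulate)
open import Level using (0ℓ)
open import Relation.Binary.PropositionalEquality using (_≡_)
open import Relation.Unary using (Pred)

-- The ground set {1,…,n} is modelled by Fin n, the element i by the index
-- i − 1. A family 𝓕 ⊆ 2^[n] is a list of subsets without repetitions, so
-- that its cardinality is the length of the list.

record Family (n : ℕ) : Set where
  constructor family
  field
    members : List (Subset n)
    unique  : Unique members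

open Family public

∥_∥ : ∀ {n} → Family n → ℕ
∥ 𝓕 ∥ = length (members 𝓕)

Member : ∀ {n} → Family n → Pred (Subset n) 0ℓ
Member 𝓕 A = A ∈ members 𝓕

-- {1,…,m} ∩ {1,…,n} as a subset of {1,…,n}.

segment : ∀ {n} → ℕ → Subset n
segment m = tabulate (λ i → toℕ i <ᵇ m)

Binom : ∀ {n} → Subset n → ℕ → Pred (Subset n) 0ℓ
Binom X k A = A ⊆ˢ X × ∣ A ∣ ≡ k

CrossIntersecting : ∀ {n} → Family n → Family n → Set
CrossIntersecting 𝓕 𝓖 = ∀ {A B} → Member 𝓕 A → Member 𝓖 B → 1 ≤ ∣ A ∩ B ∣

Intersecting : ∀ {n} → ℕ → Family n → Set
Intersecting r 𝓕 = ∀ {A B} → Member 𝓕 A → Member 𝓕 B → r ≤ ∣ A ∩ B ∣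

{-# OPTIONS --safe #-}
-- Let m = k + t + s and write S = [m]. Since all (k+t)-subsets of S belong to F, every member
-- of G meets S in at least s + 1 elements, and every member of F meets S in at least s + t + 1
-- elements. So it suffices to show
--   |F| + |G| ≤ #{A : |A| = k + t, |A ∩ S| ≥ c} + #{B : |B| = k, |B ∩ S| ≥ g}
-- with c = k + t and g = s + 1, where F contains the first family on the right and G lies in
-- the second. Keep c and g fixed and induct on n and k. If n = 2k + t, pair A with its
-- complement. If n > 2k + t and some element z lies outside S, move z to every other place by
-- shifting; once F is stable, the links of F and G at z are again cross-intersecting, the link
-- of F is (t+1)-intersecting, and the bound is the sum of the bounds for the links (with k − 1)
-- and for the members avoiding z. If S is the whole ground set, the conditions on S hold for
-- all sets or for none, and the same induction with S = ∅ applies.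
module Submission where

open import Defs
open import Algebra.Properties.CommutativeSemigroup using (interchange)
open import Data.Bool.Base using (Bool; true; false; T; _∧_; _∨_; if_then_else_)
open import Data.Bool.Properties using (T-∧) renaming (_≟_ to _≟ᵇ_)
open import Data.Empty using (⊥-elim)
open import Data.Fin.Base using (Fin; zero; suc)
open import Data.Fin.Properties using () renaming (any? to anyFin?)
open import Data.Fin.Subset using (Subset; inside; outside; _∩_; ∁; ∣_∣; ⊤; ⊥) renaming (_⊆_ to _⊆ˢ_)
open import Data.Fin.Subset.Properties hiding (_∈?_)
import Data.Fin.Subset.Properties as Subset
open import Data.List.Base using (List; length; map; sum; upTo; _∷_; [])
import Data.List.Base as List
open import Data.List.Membership.Propositional using (_∈_)
open import Data.List.Properties using (map-++; upTo-∷ʳ)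
open import Data.List.Relation.Unary.All.Properties using (All¬⇒¬Any)
open import Data.List.Relation.Unary.AllPairs using ([]; _∷_)
open import Data.List.Relation.Unary.Any using (any?)
open import Data.List.Relation.Unary.Unique.Propositional using (Unique)
open import Data.Nat.Base
open import Data.Nat.Combinatorics using (_C_; k>n⇒nCk≡0; nCk+nC[k+1]≡[n+1]C[k+1])
open import Data.Nat.Induction using (Acc; acc; <-wellFounded)
import Data.Nat.ListAction as ℕ
open import Data.Nat.ListAction.Properties using (sum-++)
open import Data.Nat.Properties
open import Data.Nat.Tactic.RingSolver using (solve-∀)
open import Data.Product.Base using (_×_; _,_; proj₁; proj₂; map₁; ∃-syntax)
open import Data.Sum.Base using (_⊎_; inj₁; inj₂)
open import Data.Vec.Base using ([]; _∷_; _++_; lookup; _[_]≔_; take; drop)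
open import Data.Vec.Properties
  using ( ≡-dec; ++-injective; take++drop≡id; zipWith-++; take-zipWith; drop-zipWith
        ; lookup-zipWith; lookup∘update; []≔-idempotent; []≔-lookup)
open import Function.Base using (_∘_; _$_)
open import Function.Bundles using (Equivalence)
open import Relation.Binary.Definitions using (DecidableEquality)
open import Relation.Binary.PropositionalEquality
  using (_≡_; refl; sym; trans; cong; cong₂; subst; subst₂)
open import Relation.Nullary using (¬_; Dec; yes; no; does; contradiction)
open import Relation.Nullary.Decidable using (⌊_⌋; toWitness; fromWitness)
open import Relation.Unary using (_⊆_)

open ≤-Reasoning

-- Sums over all subsets

∑ : ∀ {n} → (Subset n → ℕ) → ℕ
∑ {zero}  f = f []
∑ {suc n} f = ∑ (f ∘ (outside ∷_)) + ∑ (f ∘ (inside ∷_))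

+-interchange : ∀ a b c d → (a + b) + (c + d) ≡ (a + c) + (b + d)
+-interchange = interchange +-commutativeSemigroup

∑-cong : ∀ {n} {f g : Subset n → ℕ} → (∀ A → f A ≡ g A) → ∑ f ≡ ∑ g
∑-cong {zero}  eq = eq []
∑-cong {suc n} eq = cong₂ _+_ (∑-cong (eq ∘ (outside ∷_))) (∑-cong (eq ∘ (inside ∷_)))

∑-mono : ∀ {n} {f g : Subset n → ℕ} → (∀ A → f A ≤ g A) → ∑ f ≤ ∑ g
∑-mono {zero}  le = le []
∑-mono {suc n} le = +-mono-≤ (∑-mono (le ∘ (outside ∷_))) (∑-mono (le ∘ (inside ∷_)))

∑-+ : ∀ {n} (f g : Subset n → ℕ) → ∑ (λ A → f A + g A) ≡ ∑ f + ∑ g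
∑-+ {zero}  f g = refl
∑-+ {suc n} f g = trans
  (cong₂ _+_ (∑-+ (f ∘ (outside ∷_)) (g ∘ (outside ∷_))) (∑-+ (f ∘ (inside ∷_)) (g ∘ (inside ∷_))))
  (+-interchange (∑ (f ∘ (outside ∷_))) _ _ _)

∑-∁ : ∀ {n} (f : Subset n → ℕ) → ∑ (f ∘ ∁) ≡ ∑ f
∑-∁ {zero}  f = refl
∑-∁ {suc n} f = trans
  (cong₂ _+_ (∑-∁ (f ∘ (inside ∷_))) (∑-∁ (f ∘ (outside ∷_))))
  (+-comm (∑ (f ∘ (inside ∷_))) _)

-- Set families as Boolean predicates, and their cardinalities

𝟙 : Bool → ℕ
𝟙 b = if b then 1 else 0

𝟙-mono : ∀ {a b} → (T a → T b) → 𝟙 a ≤ 𝟙 b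
𝟙-mono {false}         i = z≤n
𝟙-mono {true}  {true}  i = ≤-refl
𝟙-mono {true}  {false} i = ⊥-elim (i _)

SetFamily : ℕ → Set
SetFamily n = Subset n → Bool

card : ∀ {n} → SetFamily n → ℕ
card F = ∑ (𝟙 ∘ F)

lower upper : ∀ {n} → SetFamily (suc n) → SetFamily n
lower F = F ∘ (outside ∷_)
upper F = F ∘ (inside ∷_)

infix 4 _⊑_

_⊑_ : ∀ {n} → SetFamily n → SetFamily n → Set
F ⊑ G = ∀ A → T (F A) → T (G A)

card-mono : ∀ {n} {F G : SetFamily n} → F ⊑ G → card F ≤ card G
card-mono F⊑G = ∑-mono (𝟙-mono ∘ F⊑G)

-- Split both families by the first element: a missing set in either half would make the total of
-- `F` strictly smaller. The negated hypothesis is what a failed search for a shrinking shift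
-- supplies.
⊑-antisym-card : ∀ {n} {F G : SetFamily n} → F ⊑ G → ¬ card F < card G → G ⊑ F
⊑-antisym-card {zero} {F} {G} F⊑G ≮ [] t with F [] | G []
... | true  | _    = _
... | false | true = ≮ ≤-refl
⊑-antisym-card {suc n} F⊑G ≮ (outside ∷ A) =
  ⊑-antisym-card (F⊑G ∘ (outside ∷_)) (λ lt → ≮ (+-mono-<-≤ lt (card-mono (F⊑G ∘ (inside ∷_))))) A
⊑-antisym-card {suc n} F⊑G ≮ (inside ∷ A) =
  ⊑-antisym-card (F⊑G ∘ (inside ∷_)) (λ lt → ≮ (+-mono-≤-< (card-mono (F⊑G ∘ (outside ∷_))) lt)) A

-- Exchanging the first element with another one

swap : ∀ {n} → Fin n → Subset (suc n) → Subset (suc n)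
swap x (h ∷ v) = lookup v x ∷ v [ x ]≔ h

swap-involutive : ∀ {n} (x : Fin n) A → swap x (swap x A) ≡ A
swap-involutive x (h ∷ v) = cong₂ _∷_ (lookup∘update x v h)
  (trans ([]≔-idempotent v x) ([]≔-lookup v x))

∑-swap : ∀ {n} (x : Fin n) (f : Subset (suc n) → ℕ) → ∑ (f ∘ swap x) ≡ ∑ f
∑-swap {suc n} zero f = +-interchange (∑ (λ v → f (outside ∷ outside ∷ v))) _ _ _
∑-swap {suc n} (suc x) f = trans
  (+-interchange (∑ (λ v → f (swap (suc x) (outside ∷ outside ∷ v)))) _ _ _)
  (trans (cong₂ _+_ (∑-swap x (f ∘ insert outside)) (∑-swap x (f ∘ insert inside)))
         (+-interchange (∑ (λ v → f (outside ∷ outside ∷ v))) _ _ _))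
  where
  insert : Bool → Subset (suc n) → Subset (suc (suc n))
  insert y (h ∷ v) = h ∷ y ∷ v

∣∷∣ : ∀ {n} b (v : Subset n) → ∣ b ∷ v ∣ ≡ 𝟙 b + ∣ v ∣
∣∷∣ outside v = refl
∣∷∣ inside  v = refl

∣∷∷∣ : ∀ {n} a b (v : Subset n) → ∣ a ∷ b ∷ v ∣ ≡ 𝟙 b + ∣ a ∷ v ∣
∣∷∷∣ outside b       v = ∣∷∣ b v
∣∷∷∣ inside  outside v = refl
∣∷∷∣ inside  inside  v = refl

∣swap∣ : ∀ {n} (x : Fin n) A → ∣ swap x A ∣ ≡ ∣ A ∣
∣swap∣ zero    (a ∷ b ∷ v) = trans (∣∷∣ b (a ∷ v)) (sym (∣∷∷∣ a b v))
∣swap∣ (suc x) (h ∷ y ∷ v) = trans (∣∷∷∣ (lookup v x) y (v [ x ]≔ h))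
  (trans (cong (𝟙 y +_) (∣swap∣ x (h ∷ v))) (sym (∣∷∷∣ h y v)))

[]≔-∩ : ∀ {n} (x : Fin n) a b (v w : Subset n) →
        (v [ x ]≔ a) ∩ (w [ x ]≔ b) ≡ (v ∩ w) [ x ]≔ (a ∧ b)
[]≔-∩ zero    a b (_ ∷ v) (_ ∷ w) = refl
[]≔-∩ (suc x) a b (c ∷ v) (d ∷ w) = cong ((c ∧ d) ∷_) ([]≔-∩ x a b v w)

swap-∩ : ∀ {n} (x : Fin n) A B → swap x A ∩ swap x B ≡ swap x (A ∩ B)
swap-∩ x (a ∷ v) (b ∷ w) = cong₂ _∷_ (sym (lookup-zipWith _∧_ x v w)) ([]≔-∩ x a b v w)

∣swap∩swap∣ : ∀ {n} (x : Fin n) A B → ∣ swap x A ∩ swap x B ∣ ≡ ∣ A ∩ B ∣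
∣swap∩swap∣ x A B = trans (cong ∣_∣ (swap-∩ x A B)) (∣swap∣ x (A ∩ B))

∣∷∣-mono : ∀ {m n} b {v : Subset m} {w : Subset n} → ∣ v ∣ ≤ ∣ w ∣ → ∣ b ∷ v ∣ ≤ ∣ b ∷ w ∣
∣∷∣-mono outside le = le
∣∷∣-mono inside  le = s≤s le

∣[]≔outside∩∣≤ : ∀ {n} (x : Fin n) (v w : Subset n) → ∣ (v [ x ]≔ outside) ∩ w ∣ ≤ ∣ v ∩ w ∣
∣[]≔outside∩∣≤ zero    (a ∷ v) (b ∷ w) = ∣p∣≤∣x∷p∣ (a ∧ b) (v ∩ w)
∣[]≔outside∩∣≤ (suc x) (a ∷ v) (b ∷ w) =
  ∣∷∣-mono (a ∧ b) {(v [ x ]≔ outside) ∩ w} {v ∩ w} (∣[]≔outside∩∣≤ x v w)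

-- Only the sets A containing exactly one of the first element and x matter: of A and
-- swap x A, the one containing x is in the shifted family if one of the two is in F, and
-- the other one if both are.

exchange : Bool → Bool → Bool → Bool → Bool
exchange outside inside  p q = p ∨ q
exchange inside  outside p q = p ∧ q
exchange _       _       p q = p

shift : ∀ {n} → Fin n → SetFamily (suc n) → SetFamily (suc n)
shift x F A@(h ∷ v) = exchange h (lookup v x) (F A) (F (swap x A))

-- The shift moves members from rising sets to falling ones, that is, it replaces the first element
-- by `x`.
data Falling {n} (x : Fin n) : Subset (suc n) → Set where
  falling : ∀ {v} → lookup v x ≡ inside → Falling x (outside ∷ v)

data Rising {n} (x : Fin n) : Subset (suc n) → Set where
  rising : ∀ {v} → lookup v x ≡ outside → Rising x (inside ∷ v)

[]≔-fixed : ∀ {n} (x : Fin n) {v : Subset n} {b} → lookup v x ≡ b → v ≡ v [ x ]≔ b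
[]≔-fixed x {v} refl = sym ([]≔-lookup v x)

-- Rising members survive only together with their swap, and for a set fixed by the swap both
-- memberships coincide. So knowing just one of the two is possible only for falling sets.
shift-elim : ∀ {n} (x : Fin n) (F : SetFamily (suc n)) A → T (shift x F A) →
             (T (F A) × T (F (swap x A))) ⊎ (Falling x A × (T (F A) ⊎ T (F (swap x A))))
shift-elim x F (outside ∷ v) t with lookup v x in eq
... | outside = inj₁ (t , subst (λ w → T (F (outside ∷ w))) ([]≔-fixed x eq) t)
... | inside with F (outside ∷ v) in p
...   | true  = inj₂ (falling eq , inj₁ _)
...   | false = inj₂ (falling eq , inj₂ t)
shift-elim x F (inside ∷ v) t with lookup v x in eq
... | outside = inj₁ (Equivalence.to T-∧ t)
... | inside  = inj₁ (t , subst (λ w → T (F (inside ∷ w))) ([]≔-fixed x eq) t)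

shift-intro : ∀ {n} (x : Fin n) (F : SetFamily (suc n)) A → T (F A) →
              (Rising x A → T (F (swap x A))) → T (shift x F A)
shift-intro x F (outside ∷ v) t r with lookup v x in eq
... | outside = t
... | inside with F (outside ∷ v)
...   | true  = _
shift-intro x F (inside ∷ v) t r with lookup v x in eq
... | outside = Equivalence.from T-∧ (t , r (rising eq))
... | inside  = t

-- Swapping a falling set gains only the first element, which `outside ∷ w` lacks, so the
-- intersection can at most lose `x`.
∣swap∩∣≤ : ∀ {n} {x : Fin n} {A} w → Falling x A → ∣ swap x A ∩ (outside ∷ w) ∣ ≤ ∣ A ∩ (outside ∷ w) ∣
∣swap∩∣≤ {x = x} {_ ∷ v} w (falling eq) rewrite eq = ∣[]≔outside∩∣≤ x v w

falling-swap : ∀ {n} {x : Fin n} {A} → Rising x A → Falling x (swap x A)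
falling-swap {x = x} (rising {v} eq) rewrite eq = falling (lookup∘update x v inside)

𝟙-∨-∧ : ∀ p q → 𝟙 (p ∨ q) + 𝟙 (q ∧ p) ≡ 𝟙 p + 𝟙 q
𝟙-∨-∧ false false = refl
𝟙-∨-∧ false true  = refl
𝟙-∨-∧ true  false = refl
𝟙-∨-∧ true  true  = refl

𝟙-shift : ∀ {n} (x : Fin n) (F : SetFamily (suc n)) A →
          𝟙 (shift x F A) + 𝟙 (shift x F (swap x A)) ≡ 𝟙 (F A) + 𝟙 (F (swap x A))
𝟙-shift x F A@(h ∷ v)
  rewrite lookup∘update x v h | []≔-idempotent {x = h} {y = lookup v x} v x | []≔-lookup v x
  with h | lookup v x
... | outside | outside = refl
... | inside  | inside  = refl
... | outside | inside  = 𝟙-∨-∧ (F _) _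
... | inside  | outside = trans (+-comm (𝟙 (F _ ∧ _)) _) (trans (𝟙-∨-∧ (F _) _) (+-comm (𝟙 (F _)) _))

-- The shift preserves the number of members within each pair `A`, `swap x A`; summing over all `A`
-- counts every set twice.
card-shift : ∀ {n} (x : Fin n) (F : SetFamily (suc n)) → card (shift x F) ≡ card F
card-shift x F = *-cancelˡ-≡ _ _ 2 $ trans (double (shift x F)) $
  trans (∑-cong (𝟙-shift x F)) (sym (double F))
  where
  double : ∀ G → 2 * card G ≡ ∑ (λ A → 𝟙 (G A) + 𝟙 (G (swap x A)))
  double G = trans (cong (card G +_) (trans (+-identityʳ _) (sym (∑-swap x (𝟙 ∘ G)))))
                   (sym (∑-+ (𝟙 ∘ G) (𝟙 ∘ G ∘ swap x)))

-- Intersection conditions under shifting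

Cross : ∀ {n} → ℕ → SetFamily n → SetFamily n → Set
Cross r F G = ∀ A B → T (F A) → T (G B) → r ≤ ∣ A ∩ B ∣

-- If both memberships in the original families can be taken unswapped, or both swapped, the
-- hypothesis applies because `swap x` preserves intersection sizes. Otherwise both sets are
-- falling; undoing the one swap does not shrink the intersection, since the other set lacks the
-- first element.
shift-cross : ∀ {n r} (x : Fin n) {F G : SetFamily (suc n)} →
              Cross r F G → Cross r (shift x F) (shift x G)
shift-cross {r = r} x {F} {G} cr A B a b with shift-elim x F A a | shift-elim x G B b
... | inj₁ (p , _)        | inj₁ (q , _)        = cr A B p q
... | inj₁ (p , _)        | inj₂ (_ , inj₁ q)   = cr A B p q
... | inj₁ (_ , p)        | inj₂ (_ , inj₂ q)   = subst (r ≤_) (∣swap∩swap∣ x A B) (cr _ _ p q)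
... | inj₂ (_ , inj₁ p)   | inj₁ (q , _)        = cr A B p q
... | inj₂ (_ , inj₂ p)   | inj₁ (_ , q)        = subst (r ≤_) (∣swap∩swap∣ x A B) (cr _ _ p q)
... | inj₂ (_ , inj₁ p)   | inj₂ (_ , inj₁ q)   = cr A B p q
... | inj₂ (_ , inj₂ p)   | inj₂ (_ , inj₂ q)   = subst (r ≤_) (∣swap∩swap∣ x A B) (cr _ _ p q)
... | inj₂ (f , inj₂ p)   | inj₂ (falling {w} _ , inj₁ q) = ≤-trans (cr _ _ p q) (∣swap∩∣≤ w f)
... | inj₂ (falling {v} _ , inj₁ p) | inj₂ (f , inj₂ q) = begin
  r                            ≤⟨ cr _ _ p q ⟩
  ∣ A ∩ swap x B ∣             ≡⟨ cong ∣_∣ (∩-comm A (swap x B)) ⟩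
  ∣ swap x B ∩ A ∣             ≤⟨ ∣swap∩∣≤ v f ⟩
  ∣ B ∩ A ∣                    ≡⟨ cong ∣_∣ (∩-comm B A) ⟩
  ∣ A ∩ B ∣                    ∎

-- Stable families and their links at the first element

Stable : ∀ {n} → SetFamily (suc n) → Set
Stable F = ∀ x v → lookup v x ≡ outside → T (F (inside ∷ v)) → T (F (outside ∷ v [ x ]≔ inside))

upper-shift : ∀ {n} (x : Fin n) (F : SetFamily (suc n)) → upper (shift x F) ⊑ upper F
upper-shift x F v t with shift-elim x F (inside ∷ v) t
... | inj₁ (p , _) = p

-- A rising member that survives the shift does so only because its swap is in `F` as well.
upper-shift⇒stable : ∀ {n} (F : SetFamily (suc n)) →
                     (∀ x → upper F ⊑ upper (shift x F)) → Stable F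
upper-shift⇒stable F h x v eq t with shift-elim x F (inside ∷ v) (h x v t)
... | inj₁ (_ , p) rewrite eq = p

-- By inclusion-exclusion the hypothesis says that the union of `v` and `w` has fewer than n
-- elements.
unused-element : ∀ {n} (v w : Subset n) → ∣ v ∣ + ∣ w ∣ < n + ∣ v ∩ w ∣ →
                 ∃[ x ] lookup v x ≡ outside × lookup w x ≡ outside
unused-element []            []            ()
unused-element (outside ∷ v) (outside ∷ w) lt = zero , refl , refl
unused-element {suc n} (outside ∷ v) (inside ∷ w) lt
  with x , p , q ← unused-element v w (s≤s⁻¹ (subst (_< suc (n + ∣ v ∩ w ∣)) (+-suc ∣ v ∣ ∣ w ∣) lt))
  = suc x , p , q
unused-element (inside  ∷ v) (outside ∷ w) lt
  with x , p , q ← unused-element v w (s≤s⁻¹ lt) = suc x , p , q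
unused-element {suc n} (inside  ∷ v) (inside  ∷ w) lt
  with x , p , q ← unused-element v w (s≤s⁻¹ (s≤s⁻¹ (begin
    3 + (∣ v ∣ + ∣ w ∣)         ≡⟨ cong (2 +_) (+-suc ∣ v ∣ ∣ w ∣) ⟨
    2 + (∣ v ∣ + suc ∣ w ∣)     ≤⟨ lt ⟩
    suc (n + suc ∣ v ∩ w ∣)     ≡⟨ cong suc (+-suc n ∣ v ∩ w ∣) ⟩
    2 + (n + ∣ v ∩ w ∣)         ∎)))
  = suc x , p , q

∣[]≔inside∩∣ : ∀ {n} (x : Fin n) (v w : Subset n) → lookup v x ≡ outside → lookup w x ≡ outside →
               ∣ (v [ x ]≔ inside) ∩ w ∣ ≡ ∣ v ∩ w ∣
∣[]≔inside∩∣ zero    (_ ∷ v) (_ ∷ w) refl refl = refl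
∣[]≔inside∩∣ (suc x) (a ∷ v) (b ∷ w) p q = trans (∣∷∣ (a ∧ b) ((v [ x ]≔ inside) ∩ w))
  (trans (cong (𝟙 (a ∧ b) +_) (∣[]≔inside∩∣ x v w p q)) (sym (∣∷∣ (a ∧ b) (v ∩ w))))

-- The extended sets share the first element, so `v` and `w` meet in at least r - 1 elements, and
-- the size condition leaves some `x` outside both. Replacing the first element of `inside ∷ v` by
-- `x` gives a member of `F` whose intersection with `inside ∷ w` has size exactly that of `v ∩ w`.
stable-upper-cross : ∀ {n r i j} {F G : SetFamily (suc n)} → Stable F → Cross r F G →
                     (∀ v → T (upper F v) → ∣ v ∣ ≡ i) → (∀ w → T (upper G w) → ∣ w ∣ ≡ j) →
                     i + j + 2 ≤ n + r → Cross r (upper F) (upper G)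
stable-upper-cross {n} {r} {i} {j} stable cr sizeF sizeG small v w p q
  with x , a , b ← unused-element v w (s≤s⁻¹ (begin
    2 + (∣ v ∣ + ∣ w ∣)    ≡⟨ cong₂ (λ a b → 2 + (a + b)) (sizeF v p) (sizeG w q) ⟩
    2 + (i + j)            ≡⟨ +-comm 2 (i + j) ⟩
    i + j + 2              ≤⟨ small ⟩
    n + r                  ≤⟨ +-monoʳ-≤ n (cr _ _ p q) ⟩
    n + suc ∣ v ∩ w ∣      ≡⟨ +-suc n _ ⟩
    suc (n + ∣ v ∩ w ∣)    ∎))
  = subst (r ≤_) (∣[]≔inside∩∣ x v w a b) (cr _ _ (stable x v a p) q)

-- Subsets meeting X in many elements

InSlice : ∀ {n} → ℕ → ℕ → Subset n → Subset n → Set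
InSlice k j X A = ∣ A ∣ ≡ k × j ≤ ∣ A ∩ X ∣

slice : ∀ {n} → ℕ → ℕ → Subset n → SetFamily n
slice k j X A = (∣ A ∣ ≡ᵇ k) ∧ (j ≤ᵇ ∣ A ∩ X ∣)

slice⇒InSlice : ∀ {n} k j (X : Subset n) A → T (slice k j X A) → InSlice k j X A
slice⇒InSlice k j X A t with p , q ← Equivalence.to T-∧ t = ≡ᵇ⇒≡ _ k p , ≤ᵇ⇒≤ j _ q

InSlice⇒slice : ∀ {n k j} {X : Subset n} A → InSlice k j X A → T (slice k j X A)
InSlice⇒slice A (p , q) = Equivalence.from T-∧ (≡⇒≡ᵇ _ _ p , ≤⇒≤ᵇ q)

card≤slice : ∀ {n k j} {X : Subset n} {F} → (∀ A → T (F A) → InSlice k j X A) → card F ≤ card (slice k j X)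
card≤slice {F = F} F⊆ = card-mono {F = F} λ A → InSlice⇒slice A ∘ F⊆ A

InSlice-swap : ∀ {n k j} {x : Fin n} {X : Subset n} A → Falling x A →
               InSlice k j (outside ∷ X) (swap x A) → InSlice k j (outside ∷ X) A
InSlice-swap {x = x} {X} A f (p , q) = trans (sym (∣swap∣ x A)) p , ≤-trans q (∣swap∩∣≤ X f)

shift-⊆-slice : ∀ {n k j} (x : Fin n) {X : Subset n} {F} →
                (∀ A → T (F A) → InSlice k j (outside ∷ X) A) →
                (∀ A → T (shift x F A) → InSlice k j (outside ∷ X) A)
shift-⊆-slice x {F = F} F⊆ A t with shift-elim x F A t
... | inj₁ (p , _)      = F⊆ A p
... | inj₂ (_ , inj₁ p) = F⊆ A p
... | inj₂ (f , inj₂ p) = InSlice-swap A f (F⊆ (swap x A) p)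

slice-⊆-shift : ∀ {n k j} (x : Fin n) {X : Subset n} {F} →
                (∀ A → InSlice k j (outside ∷ X) A → T (F A)) →
                (∀ A → InSlice k j (outside ∷ X) A → T (shift x F A))
slice-⊆-shift {k = k} {j} x {X} {F} ⊆F A t = shift-intro x F A (⊆F A t) λ r →
  ⊆F (swap x A) (InSlice-swap (swap x A) (falling-swap r)
    (subst (InSlice k j (outside ∷ X)) (sym (swap-involutive x A)) t))

-- The relative bound

-- The thresholds `l`, `c`, `g` are parameters separate from `k`, because they stay fixed while `k`
-- decreases. In the application they are s + t + 1, k + t and s + 1 for the initial k.
record Configuration {n} (t l c g k : ℕ) (X : Subset n) (F G : SetFamily n) : Set where
  field
    F⊆slice      : ∀ A → T (F A) → InSlice (k + t) l X A
    slice⊆F      : ∀ A → InSlice (k + t) c X A → T (F A)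
    G⊆slice      : ∀ A → T (G A) → InSlice k g X A
    intersecting : Cross (suc t) F F
    cross        : Cross 1 F G

open Configuration

Estimate : ∀ {n} (t l c g k : ℕ) → Subset n → Set
Estimate {n} t l c g k X = ∀ {F G} → Configuration t l c g k X F G →
  card F + card G ≤ card (slice (k + t) c X) + card (slice k g X)

Bound : ∀ {n} (t l c g : ℕ) → Subset n → Set
Bound {n} t l c g X = ∀ k → 2 * k + t ≤ n → Estimate t l c g k X

shift-configuration : ∀ {n t l c g k} (x : Fin n) {X : Subset n} {F G} →
                      Configuration t l c g k (outside ∷ X) F G →
                      Configuration t l c g k (outside ∷ X) (shift x F) (shift x G)
shift-configuration x 𝒞 = record
  { F⊆slice      = shift-⊆-slice x (F⊆slice 𝒞)
  ; slice⊆F      = slice-⊆-shift x (slice⊆F 𝒞)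
  ; G⊆slice      = shift-⊆-slice x (G⊆slice 𝒞)
  ; intersecting = shift-cross x (intersecting 𝒞)
  ; cross        = shift-cross x (cross 𝒞)
  }

-- Shifting `F` and `G` simultaneously keeps both cardinalities and the configuration. It is
-- repeated while some shift shrinks the link of `F`, whose size is the termination measure; when
-- none does, `F` is stable.
wlog-stable : ∀ {n t l c g k b} {X : Subset n} →
              (∀ {F G} → Stable F → Configuration t l c g k (outside ∷ X) F G → card F + card G ≤ b) →
              ∀ {F G} → Configuration t l c g k (outside ∷ X) F G → card F + card G ≤ b
wlog-stable {n} {t} {l} {c} {g} {k} {b} {X} stable-case {F} {G} 𝒞 = go F G 𝒞 (<-wellFounded _)
  where
  go : ∀ F G → Configuration t l c g k (outside ∷ X) F G → Acc _<_ (card (upper F)) → card F + card G ≤ b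
  go F G 𝒞 (acc rec) with anyFin? (λ x → card (upper (shift x F)) <? card (upper F))
  ... | yes (x , lt) = subst (_≤ b) (cong₂ _+_ (card-shift x F) (card-shift x G))
                         (go (shift x F) (shift x G) (shift-configuration x 𝒞) (rec lt))
  ... | no ∄x = stable-case (upper-shift⇒stable F λ x →
                  ⊑-antisym-card (upper-shift x F) λ lt → ∄x (x , lt)) 𝒞

-- Complementary pairs

∣∩∣+∣∁∩∣ : ∀ {n} (A X : Subset n) → ∣ A ∩ X ∣ + ∣ ∁ A ∩ X ∣ ≡ ∣ X ∣
∣∩∣+∣∁∩∣ []            []            = refl
∣∩∣+∣∁∩∣ (outside ∷ A) (outside ∷ X) = ∣∩∣+∣∁∩∣ A X
∣∩∣+∣∁∩∣ (inside  ∷ A) (outside ∷ X) = ∣∩∣+∣∁∩∣ A X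
∣∩∣+∣∁∩∣ (outside ∷ A) (inside  ∷ X) = trans (+-suc _ _) (cong suc (∣∩∣+∣∁∩∣ A X))
∣∩∣+∣∁∩∣ (inside  ∷ A) (inside  ∷ X) = cong suc (∣∩∣+∣∁∩∣ A X)

𝟙-exclusive : ∀ {a b c d} → (T a → T c ⊎ T d) → (T b → T d) → (T a → ¬ T b) →
              𝟙 a + 𝟙 b ≤ 𝟙 c + 𝟙 d
𝟙-exclusive {true}  {true}          p q r = ⊥-elim (r _ _)
𝟙-exclusive {false} {b}     {c}     p q r = ≤-trans (𝟙-mono q) (m≤n+m _ (𝟙 c))
𝟙-exclusive {true}  {false} {c} {d} p q r with p _
... | inj₁ x = ≤-trans (𝟙-mono {true} (λ _ → x)) (m≤m+n _ _)
... | inj₂ x = ≤-trans (𝟙-mono {true} (λ _ → x)) (m≤n+m _ (𝟙 c))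

-- For n = 2k + t the complement of a (k+t)-set A is a k-set, and A ∈ F excludes ∁ A ∈ G.
complement-estimate : ∀ {n t l c g k} {X : Subset n} → c + g ≤ suc ∣ X ∣ → 2 * k + t ≡ n →
                      Estimate t l c g k X
complement-estimate {n} {t} {l} {c} {g} {k} {X} c+g≤ n≡ {F} {G} 𝒞 = begin
  card F + card G                                             ≡⟨ pairs F G ⟨
  ∑ (λ A → 𝟙 (F A) + 𝟙 (G (∁ A)))                             ≤⟨ ∑-mono pair ⟩
  ∑ (λ A → 𝟙 (slice (k + t) c X A) + 𝟙 (slice k g X (∁ A)))   ≡⟨ pairs (slice (k + t) c X) (slice k g X) ⟩
  card (slice (k + t) c X) + card (slice k g X)               ∎
  where
  pairs : ∀ F G → ∑ (λ A → 𝟙 (F A) + 𝟙 (G (∁ A))) ≡ card F + card G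
  pairs F G = trans (∑-+ (𝟙 ∘ F) (𝟙 ∘ G ∘ ∁)) (cong (card F +_) (∑-∁ (𝟙 ∘ G)))

  outer : ∀ A → T (F A) → T (slice (k + t) c X A) ⊎ T (slice k g X (∁ A))
  outer A a with size , _ ← F⊆slice 𝒞 A a with c ≤? ∣ A ∩ X ∣
  ... | yes c≤ = inj₁ (InSlice⇒slice A (size , c≤))
  -- `A` meets X in at most c - 1 elements, so its complement meets X in at least |X| - c + 1 ≥ g
  -- elements and is counted by the second slice.
  ... | no  c≰ = inj₂ (InSlice⇒slice (∁ A) (
    (begin-equality
      ∣ ∁ A ∣                 ≡⟨ ∣∁p∣≡n∸∣p∣ A ⟩
      n ∸ ∣ A ∣               ≡⟨ cong₂ _∸_ (sym n≡) size ⟩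
      2 * k + t ∸ (k + t)     ≡⟨ cong (_∸ (k + t)) (split k t) ⟩
      k + (k + t) ∸ (k + t)   ≡⟨ m+n∸n≡m k (k + t) ⟩
      k                       ∎) ,
    (+-cancelˡ-≤ (suc ∣ A ∩ X ∣) _ _ (begin
      suc ∣ A ∩ X ∣ + g               ≤⟨ +-monoˡ-≤ g (≰⇒> c≰) ⟩
      c + g                           ≤⟨ c+g≤ ⟩
      suc ∣ X ∣                       ≡⟨ cong suc (∣∩∣+∣∁∩∣ A X) ⟨
      suc (∣ A ∩ X ∣ + ∣ ∁ A ∩ X ∣)   ∎))))
    where
    split : ∀ k t → 2 * k + t ≡ k + (k + t)
    split = solve-∀

  pair : ∀ A → 𝟙 (F A) + 𝟙 (G (∁ A)) ≤ 𝟙 (slice (k + t) c X A) + 𝟙 (slice k g X (∁ A))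
  pair A = 𝟙-exclusive {F A} {G (∁ A)} (outer A) (InSlice⇒slice (∁ A) ∘ G⊆slice 𝒞 (∁ A)) λ a b →
    1+n≰n (subst (1 ≤_) (trans (cong ∣_∣ (∩-inverseʳ A)) (∣⊥∣≡0 n)) (cross 𝒞 A (∁ A) a b))

-- Induction on the ground set

intersecting-size : ∀ {n t l c g k} {X : Subset n} {F G} → Configuration t l c g k X F G →
                    ∀ A → T (F A) → suc t ≤ k + t
intersecting-size {t = t} 𝒞 A a = subst (suc t ≤_)
  (trans (cong ∣_∣ (∩-idem A)) (proj₁ (F⊆slice 𝒞 A a))) (intersecting 𝒞 A A a a)

-- The new first element lies outside X, so both slices split like the families: the sets avoiding
-- it keep size parameter k + 1, the links have k, and the thresholds do not change.
peel-estimate : ∀ {n t l c g k} {X : Subset n} → 2 * suc k + t ≤ n →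
                Estimate t l c g (suc k) X → Estimate t l c g k X →
                Estimate t l c g (suc k) (outside ∷ X)
peel-estimate {n} {t} {l} {c} {g} {k} {X} 2k+t≤n est⁻ est⁺ = wlog-stable λ {F} {G} stable 𝒞 →
  ≤-trans (≤-reflexive (+-interchange (card (lower F)) _ _ _))
    (≤-trans (+-mono-≤ (est⁻ (lowerC 𝒞)) (est⁺ (upperC stable 𝒞)))
      (≤-reflexive (+-interchange (card (slice (suc k + t) c X)) _ _ _)))
  where
  lowerC : ∀ {F G} → Configuration t l c g (suc k) (outside ∷ X) F G →
           Configuration t l c g (suc k) X (lower F) (lower G)
  lowerC 𝒞 = record
    { F⊆slice      = F⊆slice 𝒞 ∘ (outside ∷_)
    ; slice⊆F      = slice⊆F 𝒞 ∘ (outside ∷_)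
    ; G⊆slice      = G⊆slice 𝒞 ∘ (outside ∷_)
    ; intersecting = λ A B → intersecting 𝒞 (outside ∷ A) (outside ∷ B)
    ; cross        = λ A B → cross 𝒞 (outside ∷ A) (outside ∷ B)
    }

  upperC : ∀ {F G} → Stable F → Configuration t l c g (suc k) (outside ∷ X) F G →
           Configuration t l c g k X (upper F) (upper G)
  upperC stable 𝒞 = record
    { F⊆slice      = F⊆
    ; slice⊆F      = λ A (p , q) → slice⊆F 𝒞 (inside ∷ A) (cong suc p , q)
    ; G⊆slice      = G⊆
    -- The room required is 2(k + t) + 2 ≤ n + t + 1 here and 2k + t + 2 ≤ n + 1 for `cross`; both
    -- follow from 2(k + 1) + t ≤ n.
    ; intersecting = stable-upper-cross stable (intersecting 𝒞) (λ v → proj₁ ∘ F⊆ v) (λ v → proj₁ ∘ F⊆ v)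
                       (≤-trans (≤-reflexive (double k t)) (+-monoˡ-≤ (suc t) (≤-trans (m∸n≤m _ 1) 2k+t≤n)))
    ; cross        = stable-upper-cross stable (cross 𝒞) (λ v → proj₁ ∘ F⊆ v) (λ v → proj₁ ∘ G⊆ v)
                       (≤-trans (≤-reflexive (single k t)) (≤-trans 2k+t≤n (m≤m+n n 1)))
    }
    where
    F⊆ = λ A → map₁ suc-injective ∘ F⊆slice 𝒞 (inside ∷ A)
    G⊆ = λ A → map₁ suc-injective ∘ G⊆slice 𝒞 (inside ∷ A)

    double : ∀ k t → k + t + (k + t) + 2 ≡ (k + suc (k + 0)) + t + suc t
    double = solve-∀

    single : ∀ k t → k + t + k + 2 ≡ 2 * suc k + t
    single = solve-∀

bound-step : ∀ {n t l c g} {X : Subset n} → c + g ≤ suc ∣ X ∣ →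
             Bound t l c g X → Bound t l c g (outside ∷ X)
-- For k = 0 a member of F would have t elements and yet meet itself in t + 1, so F is empty.
bound-step {t = t} {c = c} {X = X} _ bound zero _ 𝒞 = +-mono-≤
  (card≤slice {k = t} {c} {outside ∷ X} λ A a → ⊥-elim (1+n≰n (intersecting-size 𝒞 A a)))
  (card≤slice (G⊆slice 𝒞))
bound-step c+g≤ bound (suc k) 2k+t≤ with m≤n⇒m<n∨m≡n 2k+t≤
... | inj₂ 2k+t≡ = complement-estimate c+g≤ 2k+t≡
... | inj₁ 2k+t< = peel-estimate (s≤s⁻¹ 2k+t<) (bound (suc k) (s≤s⁻¹ 2k+t<))
  (bound k (≤-trans (+-monoˡ-≤ _ (*-monoʳ-≤ 2 (n≤1+n k))) (s≤s⁻¹ 2k+t<)))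

-- With X = ⊥ the conditions on A ∩ X are void: this is Katona's theorem for
-- (t+1)-intersecting families.
bound-⊥ : ∀ n t → Bound t 0 1 0 (⊥ {n})
bound-⊥ zero    t k 2k+t≤0 = complement-estimate ≤-refl (n≤0⇒n≡0 2k+t≤0)
bound-⊥ (suc n) t = bound-step (s≤s z≤n) (bound-⊥ n t)

-- A set meets the whole ground set in all its elements. If c ≤ k + t, the first slice contains
-- every (k+t)-set; if l > k + t, F is empty; either way the terms compare one by one. Otherwise g +
-- t ≤ l ≤ k + t gives g ≤ k, the second slice contains every k-set, and the bound for X = ∅
-- applies.
bound-⊤ : ∀ {t l c g} n → g + t ≤ l → Bound t l c g (⊤ {n})
bound-⊤ {t} {l} {c} {g} n g+t≤l k 2k+t≤n {F} {G} 𝒞 with c ≤? k + t | l ≤? k + t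
... | yes c≤ | _ = +-mono-≤ (card≤slice full) (card≤slice (G⊆slice 𝒞))
  where
  full : ∀ A → T (F A) → InSlice (k + t) c ⊤ A
  full A a with size , _ ← F⊆slice 𝒞 A a =
    size , subst (c ≤_) (sym (trans (cong ∣_∣ (∩-identityʳ A)) size)) c≤
... | no _ | no l≰ = +-mono-≤ (card≤slice empty) (card≤slice (G⊆slice 𝒞))
  where
  empty : ∀ A → T (F A) → InSlice (k + t) c ⊤ A
  empty A a with size , l≤ ← F⊆slice 𝒞 A a =
    ⊥-elim (l≰ (subst (l ≤_) (trans (cong ∣_∣ (∩-identityʳ A)) size) l≤))
... | no _ | yes l≤ = ≤-trans (bound-⊥ n t k 2k+t≤n relaxed)
  (+-mono-≤ (card≤slice {k = k + t} {c} {⊤} λ A → ⊥-elim ∘ none A ∘ slice⇒InSlice (k + t) 1 ⊥ A)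
            (card≤slice λ A → all A ∘ slice⇒InSlice k 0 ⊥ A))
  where
  none : ∀ {i} A → ¬ InSlice i 1 (⊥ {n}) A
  none A (_ , 1≤) = 1+n≰n (subst (1 ≤_) (trans (cong ∣_∣ (∩-zeroʳ A)) (∣⊥∣≡0 n)) 1≤)

  all : ∀ A → InSlice k 0 (⊥ {n}) A → InSlice k g ⊤ A
  all A (size , _) = size ,
    subst (g ≤_) (sym (trans (cong ∣_∣ (∩-identityʳ A)) size)) (+-cancelʳ-≤ t g k (≤-trans g+t≤l l≤))

  relaxed : Configuration t 0 1 0 k ⊥ F G
  relaxed = record
    { F⊆slice      = λ A a → proj₁ (F⊆slice 𝒞 A a) , z≤n
    ; slice⊆F      = λ A → ⊥-elim ∘ none A
    ; G⊆slice      = λ A a → proj₁ (G⊆slice 𝒞 A a) , z≤n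
    ; intersecting = intersecting 𝒞
    ; cross        = cross 𝒞
    }

∣⊥++∣ : ∀ r {m} (X : Subset m) → ∣ ⊥ {r} ++ X ∣ ≡ ∣ X ∣
∣⊥++∣ zero    X = refl
∣⊥++∣ (suc r) X = ∣⊥++∣ r X

-- The elements to be peeled off come first, so [m] is realised by the last m of the r + m
-- positions; rotate translates between the two conventions.
terminal : ∀ r m → Subset (r + m)
terminal r m = ⊥ {r} ++ ⊤ {m}

bound : ∀ {t l c g} r m → g + t ≤ l → c + g ≤ suc m → Bound t l c g (terminal r m)
bound zero    m g+t≤l c+g≤ = bound-⊤ m g+t≤l
bound (suc r) m g+t≤l c+g≤ = bound-step
  (subst (λ i → _ ≤ suc i) (sym (trans (∣⊥++∣ r ⊤) (∣⊤∣≡n m))) c+g≤) (bound r m g+t≤l c+g≤)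

-- Counting

∑-zero : ∀ {n} → ∑ {n} (λ _ → 0) ≡ 0
∑-zero {zero}  = refl
∑-zero {suc n} = cong₂ _+_ (∑-zero {n}) (∑-zero {n})

∑-*ˡ : ∀ {n} c (f : Subset n → ℕ) → ∑ (λ A → c * f A) ≡ c * ∑ f
∑-*ˡ {zero}  c f = refl
∑-*ˡ {suc n} c f = trans (cong₂ _+_ (∑-*ˡ c (f ∘ (outside ∷_))) (∑-*ˡ c (f ∘ (inside ∷_))))
                         (sym (*-distribˡ-+ c (∑ (f ∘ (outside ∷_))) _))

∑-++ : ∀ r {m} (f : Subset (r + m) → ℕ) → ∑ f ≡ ∑ {r} (λ w → ∑ {m} (λ u → f (w ++ u)))
∑-++ zero    f = refl
∑-++ (suc r) f = cong₂ _+_ (∑-++ r (f ∘ (outside ∷_))) (∑-++ r (f ∘ (inside ∷_)))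

∑-comm : ∀ r {m} (f : Subset r → Subset m → ℕ) → ∑ (λ w → ∑ (f w)) ≡ ∑ (λ u → ∑ (λ w → f w u))
∑-comm zero    f = refl
∑-comm (suc r) f = trans (cong₂ _+_ (∑-comm r (f ∘ (outside ∷_))) (∑-comm r (f ∘ (inside ∷_))))
                         (sym (∑-+ (λ u → ∑ (λ w → f (outside ∷ w) u)) _))

∑-size : ∀ n k → ∑ {n} (λ A → 𝟙 (∣ A ∣ ≡ᵇ k)) ≡ n C k
∑-size zero    zero    = refl
∑-size zero    (suc k) = sym (k>n⇒nCk≡0 {0} {suc k} (s≤s z≤n))
∑-size (suc n) zero    = cong₂ _+_ (∑-size n 0) (∑-zero {n})
∑-size (suc n) (suc k) = trans (cong₂ _+_ (∑-size n (suc k)) (∑-size n k))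
  (trans (+-comm (n C suc k) (n C k)) (nCk+nC[k+1]≡[n+1]C[k+1] n k))

∣++∣ : ∀ {r m} (w : Subset r) (u : Subset m) → ∣ w ++ u ∣ ≡ ∣ w ∣ + ∣ u ∣
∣++∣ []            u = refl
∣++∣ (outside ∷ w) u = ∣++∣ w u
∣++∣ (inside  ∷ w) u = cong suc (∣++∣ w u)

∣∩terminal∣ : ∀ r m (w : Subset r) (u : Subset m) → ∣ (w ++ u) ∩ terminal r m ∣ ≡ ∣ u ∣
∣∩terminal∣ r m w u = begin-equality
  ∣ (w ++ u) ∩ terminal r m ∣        ≡⟨ cong ∣_∣ (zipWith-++ _∧_ w u (⊥ {r}) (⊤ {m})) ⟩
  ∣ (w ∩ ⊥ {r}) ++ (u ∩ ⊤ {m}) ∣     ≡⟨ cong₂ (λ v x → ∣ v ++ x ∣) (∩-zeroʳ w) (∩-identityʳ u) ⟩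
  ∣ ⊥ {r} ++ u ∣                     ≡⟨ ∣⊥++∣ r u ⟩
  ∣ u ∣                              ∎

≡+*0 : ∀ a b → a ≡ a + b * 0
≡+*0 = solve-∀

-- Here `a` and `b` are the sizes of the parts of a set outside and inside [m]. Raising the
-- threshold from j to j + 1 drops exactly the sets with b = j, and j ≤ k makes the truncated
-- difference exact.
𝟙-slice : ∀ a b k j → j ≤ k →
  𝟙 ((a + b ≡ᵇ k) ∧ (j ≤ᵇ b)) ≡ 𝟙 ((a + b ≡ᵇ k) ∧ (suc j ≤ᵇ b)) + 𝟙 (a ≡ᵇ k ∸ j) * 𝟙 (b ≡ᵇ j)
𝟙-slice a zero k zero _ rewrite +-identityʳ a with a ≡ᵇ k
... | true  = refl
... | false = refl
𝟙-slice a (suc b) k zero _ = ≡+*0 _ (𝟙 (a ≡ᵇ k))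
𝟙-slice a zero k (suc j) _ = ≡+*0 _ (𝟙 (a ≡ᵇ k ∸ suc j))
𝟙-slice a (suc b) (suc k) (suc j) (s≤s j≤k) rewrite +-suc a b with 𝟙-slice a b k j j≤k
-- The split on `j` only lets `_≤ᵇ_` compute.
... | eq with j
...   | zero  = eq
...   | suc _ = eq

-- With `A` written as `w ++ u`, the dropped sets have k - j elements in `w` and j in `u`, chosen
-- independently, so their number factors.
card-slice-suc : ∀ r m k j → j ≤ k →
  card (slice k j (terminal r m)) ≡ card (slice k (suc j) (terminal r m)) + (m C j) * (r C (k ∸ j))
card-slice-suc r m k j j≤k = begin-equality
  card (slice k j X)
    ≡⟨ split j ⟩
  ∑ (λ w → ∑ (λ u → S j w u))
    ≡⟨ ∑-cong {r} (λ w → ∑-cong {m} (λ u → 𝟙-slice ∣ w ∣ ∣ u ∣ k j j≤k)) ⟩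
  ∑ (λ w → ∑ (λ u → S (suc j) w u + P w * Q u))
    ≡⟨ ∑-cong (λ w → ∑-+ (S (suc j) w) (λ u → P w * Q u)) ⟩
  ∑ (λ w → ∑ (S (suc j) w) + ∑ (λ u → P w * Q u))
    ≡⟨ ∑-+ (λ w → ∑ (S (suc j) w)) _ ⟩
  ∑ (λ w → ∑ (S (suc j) w)) + ∑ (λ w → ∑ (λ u → P w * Q u))
    ≡⟨ cong₂ _+_ (sym (split (suc j))) (∑-cong (λ w → trans (∑-*ˡ (P w) Q) (*-comm (P w) (∑ Q)))) ⟩
  card (slice k (suc j) X) + ∑ (λ w → ∑ Q * P w)
    ≡⟨ cong (card (slice k (suc j) X) +_) (∑-*ˡ (∑ Q) P) ⟩
  card (slice k (suc j) X) + ∑ Q * ∑ P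
    ≡⟨ cong (card (slice k (suc j) X) +_) (cong₂ _*_ (∑-size m j) (∑-size r (k ∸ j))) ⟩
  card (slice k (suc j) X) + (m C j) * (r C (k ∸ j))
    ∎
  where
  X = terminal r m

  S : ℕ → Subset r → Subset m → ℕ
  S i w u = 𝟙 ((∣ w ∣ + ∣ u ∣ ≡ᵇ k) ∧ (i ≤ᵇ ∣ u ∣))

  P : Subset r → ℕ
  P w = 𝟙 (∣ w ∣ ≡ᵇ k ∸ j)

  Q : Subset m → ℕ
  Q u = 𝟙 (∣ u ∣ ≡ᵇ j)

  split : ∀ i → card (slice k i X) ≡ ∑ (λ w → ∑ (λ u → S i w u))
  split i = trans (∑-++ r (𝟙 ∘ slice k i X)) (∑-cong {r} λ w → ∑-cong {m} λ u →
    cong₂ (λ a b → 𝟙 ((a ≡ᵇ k) ∧ (i ≤ᵇ b))) (∣++∣ w u) (∣∩terminal∣ r m w u))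

card-slice-0 : ∀ {n} k (X : Subset n) → card (slice k 0 X) ≡ n C k
card-slice-0 {n} k X = trans (∑-cong pointwise) (∑-size n k)
  where
  pointwise : ∀ A → 𝟙 (slice k 0 X A) ≡ 𝟙 (∣ A ∣ ≡ᵇ k)
  pointwise A with ∣ A ∣ ≡ᵇ k
  ... | true  = refl
  ... | false = refl

-- Telescoping of `card-slice-suc` from threshold 0, kept additive to avoid truncated subtraction.
-- The threshold may reach k + 1 because the last summand has index j - 1.
card-slice : ∀ r m k j → j ≤ suc k →
  card (slice k j (terminal r m)) + ℕ.sum (map (λ i → (m C i) * (r C (k ∸ i))) (upTo j)) ≡ (r + m) C k
card-slice r m k zero    _         = trans (+-identityʳ _) (card-slice-0 k (terminal r m))
card-slice r m k (suc j) (s≤s j≤k) = begin-equality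
  card (slice k (suc j) X) + ℕ.sum (map f (upTo (suc j)))         ≡⟨ cong (card (slice k (suc j) X) +_) snoc ⟩
  card (slice k (suc j) X) + (ℕ.sum (map f (upTo j)) + f j)       ≡⟨ rearrange (card (slice k (suc j) X)) _ (f j) ⟩
  card (slice k (suc j) X) + f j + ℕ.sum (map f (upTo j))         ≡⟨ cong (_+ ℕ.sum (map f (upTo j))) (card-slice-suc r m k j j≤k) ⟨
  card (slice k j X) + ℕ.sum (map f (upTo j))                     ≡⟨ card-slice r m k j (m≤n⇒m≤1+n j≤k) ⟩
  (r + m) C k                                                   ∎
  where
  X = terminal r m

  f : ℕ → ℕ
  f i = (m C i) * (r C (k ∸ i))

  snoc : ℕ.sum (map f (upTo (suc j))) ≡ ℕ.sum (map f (upTo j)) + f j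
  snoc = begin-equality
    ℕ.sum (map f (upTo (suc j)))                ≡⟨ cong (ℕ.sum ∘ map f) (upTo-∷ʳ j) ⟨
    ℕ.sum (map f (upTo j List.++ j ∷ []))             ≡⟨ cong ℕ.sum (map-++ f (upTo j) (j ∷ [])) ⟩
    ℕ.sum (map f (upTo j) List.++ f j ∷ [])           ≡⟨ sum-++ (map f (upTo j)) (f j ∷ []) ⟩
    ℕ.sum (map f (upTo j)) + (f j + 0)          ≡⟨ cong (ℕ.sum (map f (upTo j)) +_) (+-identityʳ (f j)) ⟩
    ℕ.sum (map f (upTo j)) + f j                ∎

  rearrange : ∀ a b c → a + (b + c) ≡ a + c + b
  rearrange = solve-∀

-- No k-set meets X in k + 1 elements, so only the summand at j = k remains, with second factor 1.
card-slice-full : ∀ r m k → card (slice k k (terminal r m)) ≡ m C k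
card-slice-full r m k = begin-equality
  card (slice k k X)                                     ≡⟨ card-slice-suc r m k k ≤-refl ⟩
  card (slice k (suc k) X) + (m C k) * (r C (k ∸ k))     ≡⟨ cong₂ _+_ none (cong (λ i → (m C k) * (r C i)) (n∸n≡0 k)) ⟩
  (m C k) * 1                                            ≡⟨ *-identityʳ (m C k) ⟩
  m C k                                                  ∎
  where
  X = terminal r m

  none : card (slice k (suc k) X) ≡ 0
  none = n≤0⇒n≡0 (≤-trans (card-mono {F = slice k (suc k) X} {λ _ → false} λ A a →
      let size , k< = slice⇒InSlice k (suc k) X A a
      in <⇒≱ k< (subst (∣ A ∩ X ∣ ≤_) size (∣p∩q∣≤∣p∣ A X)))
    (≤-reflexive (∑-zero {r + m})))

-- From lists of sets to indicator functions

_≟ˢ_ : ∀ {n} → DecidableEquality (Subset n)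
_≟ˢ_ = ≡-dec _≟ᵇ_

∑-≟ : ∀ {n} (B : Subset n) → ∑ (λ A → 𝟙 (does (A ≟ˢ B))) ≡ 1
∑-≟ []                    = refl
∑-≟ {suc n} (outside ∷ B) = cong₂ _+_ (∑-≟ B) (∑-zero {n})
∑-≟ {suc n} (inside  ∷ B) = cong₂ _+_ (∑-zero {n}) (∑-≟ B)

_∈?_ : ∀ {n} (A : Subset n) (xs : List (Subset n)) → Dec (A ∈ xs)
A ∈? xs = any? (A ≟ˢ_) xs

indicator : ∀ {n} → List (Subset n) → SetFamily n
indicator xs A = ⌊ A ∈? xs ⌋

-- Since the head does not recur in the tail, its indicator and that of the tail are disjoint.
length≤card : ∀ {n} {xs : List (Subset n)} → Unique xs → length xs ≤ card (indicator xs)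
length≤card []                           = z≤n
length≤card {xs = B ∷ xs} (B∉ ∷ unique) = begin
  suc (length xs)                                                  ≤⟨ s≤s (length≤card unique) ⟩
  1 + card (indicator xs)                                          ≡⟨ cong (_+ card (indicator xs)) (∑-≟ B) ⟨
  ∑ (λ A → 𝟙 (does (A ≟ˢ B))) + card (indicator xs)                ≡⟨ ∑-+ _ (𝟙 ∘ indicator xs) ⟨
  ∑ (λ A → 𝟙 (does (A ≟ˢ B)) + 𝟙 (indicator xs A))                 ≤⟨ ∑-mono disjoint ⟩
  card (indicator (B ∷ xs))                                        ∎
  where
  disjoint : ∀ A → 𝟙 (does (A ≟ˢ B)) + 𝟙 (indicator xs A) ≤ 𝟙 (indicator (B ∷ xs) A)
  disjoint A with A ≟ˢ B | A ∈? xs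
  ... | no _     | no _  = z≤n
  ... | no _     | yes _ = ≤-refl
  ... | yes _    | no _  = ≤-refl
  ... | yes refl | yes p = contradiction p (All¬⇒¬Any B∉)

-- Moving the first r positions to the end

rotate : ∀ r {m} → Subset (r + m) → Subset (m + r)
rotate r A = drop r A ++ take r A

rotate-++ : ∀ {r m} (w : Subset r) (u : Subset m) → rotate r (w ++ u) ≡ u ++ w
rotate-++ {r} w u with p , q ← ++-injective (take r (w ++ u)) w (take++drop≡id r (w ++ u)) =
  cong₂ _++_ q p

card-rotate : ∀ r {m} (F : SetFamily (m + r)) → card (F ∘ rotate r) ≡ card F
card-rotate r {m} F = begin-equality
  card (F ∘ rotate r)                                     ≡⟨ ∑-++ r (𝟙 ∘ F ∘ rotate r) ⟩
  ∑ {r} (λ w → ∑ {m} (λ u → 𝟙 (F (rotate r (w ++ u)))))       ≡⟨ ∑-cong {r} (λ w → ∑-cong {m} λ u → cong (𝟙 ∘ F) (rotate-++ w u)) ⟩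
  ∑ {r} (λ w → ∑ {m} (λ u → 𝟙 (F (u ++ w))))              ≡⟨ ∑-comm r (λ w u → 𝟙 (F (u ++ w))) ⟩
  ∑ {m} (λ u → ∑ {r} (λ w → 𝟙 (F (u ++ w))))              ≡⟨ ∑-++ m (𝟙 ∘ F) ⟨
  card F                                                  ∎

∣rotate∣ : ∀ r {m} (A : Subset (r + m)) → ∣ rotate r A ∣ ≡ ∣ A ∣
∣rotate∣ r A = begin-equality
  ∣ drop r A ++ take r A ∣         ≡⟨ ∣++∣ (drop r A) (take r A) ⟩
  ∣ drop r A ∣ + ∣ take r A ∣      ≡⟨ +-comm ∣ drop r A ∣ _ ⟩
  ∣ take r A ∣ + ∣ drop r A ∣      ≡⟨ ∣++∣ (take r A) (drop r A) ⟨
  ∣ take r A ++ drop r A ∣         ≡⟨ cong ∣_∣ (take++drop≡id r A) ⟩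
  ∣ A ∣                            ∎

rotate-∩ : ∀ r {m} (A B : Subset (r + m)) → rotate r (A ∩ B) ≡ rotate r A ∩ rotate r B
rotate-∩ r A B = trans (cong₂ _++_ (drop-zipWith {m = r} _∧_ A B) (take-zipWith {m = r} _∧_ A B))
  (sym (zipWith-++ _∧_ (drop r A) (take r A) (drop r B) (take r B)))

∣rotate∩rotate∣ : ∀ r {m} (A B : Subset (r + m)) → ∣ rotate r A ∩ rotate r B ∣ ≡ ∣ A ∩ B ∣
∣rotate∩rotate∣ r A B = trans (cong ∣_∣ (sym (rotate-∩ r A B))) (∣rotate∣ r (A ∩ B))

segment-0 : ∀ r → segment {r} 0 ≡ ⊥
segment-0 zero    = refl
segment-0 (suc r) = cong (outside ∷_) (segment-0 r)

segment-++ : ∀ m r → segment {m + r} m ≡ ⊤ {m} ++ ⊥ {r}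
segment-++ zero    r = segment-0 r
segment-++ (suc m) r = cong (inside ∷_) (segment-++ m r)

∣segment∣ : ∀ m r → ∣ segment {m + r} m ∣ ≡ m
∣segment∣ m r = trans (cong ∣_∣ (segment-++ m r)) (trans (∣++∣ (⊤ {m}) ⊥)
  (trans (cong₂ _+_ (∣⊤∣≡n m) (∣⊥∣≡0 r)) (+-identityʳ m)))

∣∩segment∣ : ∀ r {m} (A : Subset (r + m)) → ∣ rotate r A ∩ segment m ∣ ≡ ∣ A ∩ terminal r m ∣
∣∩segment∣ r {m} A = trans
  (cong (λ S → ∣ rotate r A ∩ S ∣) (trans (segment-++ m r) (sym (rotate-++ (⊥ {r}) (⊤ {m})))))
  (∣rotate∩rotate∣ r A (terminal r m))

-- How far members must meet [m]

∣p∣≤∣p∩q∣⇒p⊆q : ∀ {n} {A S : Subset n} → ∣ A ∣ ≤ ∣ A ∩ S ∣ → A ⊆ˢ S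
∣p∣≤∣p∩q∣⇒p⊆q {A = A} {S} le {x} x∈A with x Subset.∈? S
... | yes x∈S = x∈S
... | no  x∉S = ⊥-elim (<⇒≱ (p⊂q⇒∣p∣<∣q∣ (p∩q⊆p A S , x , x∈A , x∉S ∘ p∩q⊆q A S)) le)

-- At least i elements of `B` are taken from S outside `A`, so at most j can lie in `A`.
avoiding-subset : ∀ {n} (A S : Subset n) i j → i ≤ ∣ ∁ A ∩ S ∣ → i + j ≤ ∣ S ∣ →
                  ∃[ B ] B ⊆ˢ S × ∣ B ∣ ≡ i + j × ∣ A ∩ B ∣ ≤ j
avoiding-subset [] [] zero zero _ _ = [] , ⊆-refl , refl , z≤n
avoiding-subset (outside ∷ A) (outside ∷ S) i j p q
  with B , sub , size , meet ← avoiding-subset A S i j p q = outside ∷ B , s⊆s sub , size , meet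
avoiding-subset (inside ∷ A) (outside ∷ S) i j p q
  with B , sub , size , meet ← avoiding-subset A S i j p q = outside ∷ B , s⊆s sub , size , meet
avoiding-subset (outside ∷ A) (inside ∷ S) (suc i) j p q
  with B , sub , size , meet ← avoiding-subset A S i j (s≤s⁻¹ p) (s≤s⁻¹ q) = inside ∷ B , s⊆s sub , cong suc size , meet
avoiding-subset (outside ∷ A) (inside ∷ S) zero zero p q
  with B , sub , size , meet ← avoiding-subset A S zero zero z≤n z≤n = outside ∷ B , out⊆ sub , size , meet
avoiding-subset (outside ∷ A) (inside ∷ S) zero (suc j) p q
  with B , sub , size , meet ← avoiding-subset A S zero j z≤n (s≤s⁻¹ q) =
  inside ∷ B , s⊆s sub , cong suc size , m≤n⇒m≤1+n meet
avoiding-subset (inside ∷ A) (inside ∷ S) i zero p q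
  with B , sub , size , meet ← avoiding-subset A S i zero p
         (≤-trans (≤-reflexive (+-identityʳ i)) (≤-trans p (∣p∩q∣≤∣q∣ (∁ A) S))) =
  outside ∷ B , out⊆ sub , size , meet
avoiding-subset (inside ∷ A) (inside ∷ S) i (suc j) p q
  with B , sub , size , meet ← avoiding-subset A S i j p (s≤s⁻¹ (≤-trans (≤-reflexive (sym (+-suc i j))) q)) =
  inside ∷ B , s⊆s sub , trans (cong suc size) (sym (+-suc i j)) , s≤s meet

-- If `A` met S in at most h elements, at least m - h = i elements of S would avoid `A`, and some
-- (i+j)-subset of S would meet `A` in at most j; j ≤ h ensures that S is large enough. Used with j
-- = t, h = s + t for 𝓕 and with j = 0, h = s for 𝓖.
meets-segment : ∀ {n i j m h} (A S : Subset n) → ∣ S ∣ ≡ m → m ≡ i + h → j ≤ h →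
                (∀ B → Binom S (i + j) B → suc j ≤ ∣ A ∩ B ∣) → suc h ≤ ∣ A ∩ S ∣
meets-segment {i = i} {j} {h = h} A S refl m≡ j≤h meet with suc h ≤? ∣ A ∩ S ∣
... | yes le = le
... | no  ≰
  with B , sub , size , few ← avoiding-subset A S i j
         (+-cancelˡ-≤ h i _ (begin
           h + i                          ≡⟨ +-comm h i ⟩
           i + h                          ≡⟨ m≡ ⟨
           ∣ S ∣                          ≡⟨ ∣∩∣+∣∁∩∣ A S ⟨
           ∣ A ∩ S ∣ + ∣ ∁ A ∩ S ∣        ≤⟨ +-monoˡ-≤ _ (s≤s⁻¹ (≰⇒> ≰)) ⟩
           h + ∣ ∁ A ∩ S ∣                ∎))
         (≤-trans (+-monoʳ-≤ i j≤h) (≤-reflexive (sym m≡)))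
  = ⊥-elim (<⇒≱ (meet B (sub , size)) few)

-- The bound for the given families

indicator⇒member : ∀ {n} (𝓕 : Family n) A → T (indicator (members 𝓕) A) → Member 𝓕 A
indicator⇒member 𝓕 A = toWitness {a? = A ∈? members 𝓕}

member⇒indicator : ∀ {n} (𝓕 : Family n) A → Member 𝓕 A → T (indicator (members 𝓕) A)
member⇒indicator 𝓕 A = fromWitness {a? = A ∈? members 𝓕}

-- The theorem with n written as k + t + s + r and the subtracted sum moved to the left, so that it
-- can be stated over the naturals.
family-bound : ∀ t s k r → s + 1 ≤ k → 2 * k + t ≤ k + t + s + r →
  (𝓕 𝓖 : Family (k + t + s + r)) →
  Member 𝓕 ⊆ Binom (segment (k + t + s + r)) (k + t) →
  Member 𝓖 ⊆ Binom (segment (k + t + s + r)) k →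
  CrossIntersecting 𝓕 𝓖 →
  Intersecting (t + 1) 𝓕 →
  Binom (segment (k + t + s)) (k + t) ⊆ Member 𝓕 →
  ∥ 𝓕 ∥ + ∥ 𝓖 ∥ + ℕ.sum (map (λ i → ((k + t + s) C i) * (r C (k ∸ i))) (upTo (suc s)))
    ≤ ((k + t + s) C (k + t)) + ((k + t + s + r) C k)
family-bound t s k r s<k 2k+t≤ 𝓕 𝓖 𝓕⊆ 𝓖⊆ cross intersecting ⊆𝓕 = begin
  ∥ 𝓕 ∥ + ∥ 𝓖 ∥ + Σ                                       ≤⟨ +-monoˡ-≤ Σ (+-mono-≤ (length≤card (unique 𝓕)) (length≤card (unique 𝓖))) ⟩
  card (indicator (members 𝓕)) + card (indicator (members 𝓖)) + Σ
    ≡⟨ cong (_+ Σ) (cong₂ _+_ (card-rotate r (indicator (members 𝓕))) (card-rotate r (indicator (members 𝓖)))) ⟨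
  card F + card G + Σ                                     ≤⟨ +-monoˡ-≤ Σ (bound r m ≤-refl (≤-reflexive (+-suc (k + t) s)) k
                                                               (≤-trans 2k+t≤ (≤-reflexive (+-comm m r))) config) ⟩
  card (slice (k + t) (k + t) X) + card (slice k (suc s) X) + Σ
    ≡⟨ +-assoc (card (slice (k + t) (k + t) X)) _ Σ ⟩
  card (slice (k + t) (k + t) X) + (card (slice k (suc s) X) + Σ)
    ≡⟨ cong₂ _+_ (card-slice-full r m (k + t)) (card-slice r m k (suc s) (m≤n⇒m≤1+n suc-s≤k)) ⟩
  (m C (k + t)) + ((r + m) C k)                           ≡⟨ cong (λ n → (m C (k + t)) + (n C k)) (+-comm r m) ⟩
  (m C (k + t)) + ((m + r) C k)                           ∎
  where
  m = k + t + s
  X = terminal r m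
  S = segment {m + r} m
  Σ = ℕ.sum (map (λ i → (m C i) * (r C (k ∸ i))) (upTo (suc s)))
  F = indicator (members 𝓕) ∘ rotate r
  G = indicator (members 𝓖) ∘ rotate r

  suc-s≤k : suc s ≤ k
  suc-s≤k = ≤-trans (≤-reflexive (+-comm 1 s)) s<k

  inF : ∀ A → T (F A) → Member 𝓕 (rotate r A)
  inF A = indicator⇒member 𝓕 (rotate r A)

  inG : ∀ A → T (G A) → Member 𝓖 (rotate r A)
  inG A = indicator⇒member 𝓖 (rotate r A)

  𝓕-meets : ∀ {A} → Member 𝓕 A → suc (s + t) ≤ ∣ A ∩ S ∣
  𝓕-meets {A} a = meets-segment {i = k} {t} A S (∣segment∣ m r)
    (trans (+-assoc k t s) (cong (k +_) (+-comm t s))) (m≤n+m t s)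
    λ B b → ≤-trans (≤-reflexive (+-comm 1 t)) (intersecting a (⊆𝓕 b))

  𝓖-meets : ∀ {A} → Member 𝓖 A → suc s ≤ ∣ A ∩ S ∣
  𝓖-meets {A} a = meets-segment {i = k + t} {0} A S (∣segment∣ m r) refl z≤n
    λ B b → ≤-trans (cross (⊆𝓕 (subst (λ i → Binom S i B) (+-identityʳ (k + t)) b)) a)
                    (≤-reflexive (cong ∣_∣ (∩-comm B A)))

  config : Configuration t (suc (s + t)) (k + t) (suc s) k X F G
  config = record
    { F⊆slice = λ A a → trans (sym (∣rotate∣ r A)) (proj₂ (𝓕⊆ (inF A a)))
                      , subst (suc (s + t) ≤_) (∣∩segment∣ r A) (𝓕-meets (inF A a))
    -- A (k+t)-set meeting [m] in k + t elements is a subset of [m], hence in 𝓕 by hypothesis.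
    ; slice⊆F = λ A (size , full) → member⇒indicator 𝓕 (rotate r A) (⊆𝓕
        ( ∣p∣≤∣p∩q∣⇒p⊆q (subst₂ _≤_ (sym (trans (∣rotate∣ r A) size)) (sym (∣∩segment∣ r A)) full)
        , trans (∣rotate∣ r A) size))
    ; G⊆slice = λ A a → trans (sym (∣rotate∣ r A)) (proj₂ (𝓖⊆ (inG A a)))
                      , subst (suc s ≤_) (∣∩segment∣ r A) (𝓖-meets (inG A a))
    ; intersecting = λ A B a b → subst₂ _≤_ (+-comm t 1) (∣rotate∩rotate∣ r A B) (intersecting (inF A a) (inF B b))
    ; cross = λ A B a b → subst (1 ≤_) (∣rotate∩rotate∣ r A B) (cross (inF A a) (inG B b))
    }

k+t+s≤n : ∀ {k t s n} → s + 1 ≤ k → 2 * k + t ≤ n → k + t + s ≤ n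
k+t+s≤n {k} {t} {s} {n} s<k 2k+t≤n = begin
  k + t + s     ≤⟨ +-monoʳ-≤ (k + t) (m+n≤o⇒m≤o s s<k) ⟩
  k + t + k     ≡⟨ rearrange k t ⟩
  2 * k + t     ≤⟨ 2k+t≤n ⟩
  n             ∎
  where
  rearrange : ∀ k t → k + t + k ≡ 2 * k + t
  rearrange = solve-∀

open import Data.Integer.Base as ℤ using (+_)
import Data.Integer.Properties as ℤ

≤-minus : ∀ {a b c} → a + c ≤ b → (+ a) ℤ.≤ (+ b) ℤ.- (+ c)
≤-minus {a} {b} {c} le = subst (+ a ℤ.≤_)
  (sym (trans (ℤ.m-n≡m⊖n b c) (ℤ.⊖-≥ (m+n≤o⇒n≤o a le))))
  (ℤ.+≤+ (m+n≤o⇒m≤o∸n a le))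

mainTheorem1 : ∀ (t s k n : ℕ) → s + 1 ≤ k → 2 * k + t ≤ n →
    (𝓕 𝓖 : Family n) →
    Member 𝓕 ⊆ Binom (segment n) (k + t) →
    Member 𝓖 ⊆ Binom (segment n) k →
    CrossIntersecting 𝓕 𝓖 →
    Intersecting (t + 1) 𝓕 →
    Binom (segment (k + t + s)) (k + t) ⊆ Member 𝓕 →
    (+ ∥ 𝓕 ∥) ℤ.+ (+ ∥ 𝓖 ∥) ℤ.≤
    (+ ((k + t + s) C (k + t))) ℤ.+ (+ (n C k)) ℤ.-
    (+ sum (map (λ i → ((k + t + s) C i) * ((n ∸ (k + t + s)) C (k ∸ i))) (upTo (suc s))))
mainTheorem1 t s k n s<k 2k+t≤n 𝓕 𝓖 𝓕⊆ 𝓖⊆ cross intersecting ⊆𝓕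
  -- `r` is the number of elements outside [k + t + s].
  with r , refl ← m≤n⇒∃[o]m+o≡n (k+t+s≤n {k} s<k 2k+t≤n)
  rewrite m+n∸m≡n (k + t + s) r
  = ≤-minus (family-bound t s k r s<k 2k+t≤n 𝓕 𝓖 𝓕⊆ 𝓖⊆ cross intersecting ⊆𝓕)
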